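{- For every subcubic bipartite graph $G$, $\chi'_{\mathrm{inj}}(G)\leq 6$.
   Context: All graphs are finite and simple. A graph is subcubic if its maximum degree is at most $3$. Three edges $e_1,e_2,e_3$ of a graph are consecutive if they form (in this order) a path of length three or a cycle of length three. An injective edge-coloring of $G$ with $k$ colors is a map $c:E(G)\to\{1,\dots,k\}$ (not necessarily a proper edge-coloring) such that $c(e_1)\neq c(e_3)$ whenever $e_1,e_2,e_3$ are consecutive edges in $G$. The injective chromatic index $\chi'_{\mathrm{inj}}(G)$ is the minimum $k$ such that $G$ has an injective edge-coloring with $k$ colors. -}

module Defs where

open import Data.Bool.Base using (Bool)
open import Data.Fin.Base using (Fin; _<_; finToFun; funToFin)
open import Data.Fin.Properties using (_≟_; _<?_; any?; finToFun-funToFin)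
open import Data.List.Base using (List; []; _∷_; [_]; length; map; filter; concatMap; allFin; cartesianProduct; lookup)
open import Data.List.Extrema.Nat using (max)
open import Data.List.Membership.Propositional using (_∈_; lose)
open import Data.List.Membership.Propositional.Properties using (∈-allFin; ∈-cartesianProduct⁺; ∈-concatMap⁺)
open import Data.List.Relation.Unary.All as All using (all?; []; _∷_)
open import Data.List.Relation.Unary.AllPairs using ([]; _∷_)
open import Data.List.Relation.Unary.Any as Any using (here)
open import Data.List.Relation.Unary.Any.Properties using (lookup-index)
open import Data.List.Relation.Unary.Unique.Propositional using (Unique)
open import Data.Nat.Base as ℕ using (ℕ; _≤_)
open import Data.Nat.Induction using (<-rec)
import Data.Nat.Properties as ℕ
open import Data.Product.Base using (∃; ∃-syntax; _×_; _,_; proj₁; proj₂)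
open import Data.Sum.Base using (_⊎_; inj₁; inj₂)
open import Function.Base using (_∘_)
open import Level using (0ℓ)
open import Relation.Binary.Core using (Rel)
open import Relation.Binary.Definitions using (Decidable; Symmetric)
open import Relation.Binary.PropositionalEquality using (_≡_; _≢_; refl; sym; trans; cong)
open import Relation.Nullary.Decidable using (Dec; yes; no; _×-dec_; _⊎-dec_; _→-dec_; ¬?; map′)
open import Relation.Nullary.Negation.Core using (¬_; contradiction-irr)
import Data.List.Relation.Unary.Unique.DecPropositional as DecUnique
import Relation.Unary as U

record Graph : Set₁ where
  field
    order     : ℕ

  Vertex : Set
  Vertex = Fin order

  field
    Adj       : Rel Vertex 0ℓ
    Adj?      : Decidable Adj
    symmetric : Symmetric Adj
    loopless  : ∀ v → ¬ Adj v v

  degree : Vertex → ℕ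
  degree v = length (filter (Adj? v) (allFin order))

  -- Equal to 0 for the graph without vertices.
  maxDegree : ℕ
  maxDegree = max 0 (map degree (allFin order))

  -- An edge is an unordered pair of adjacent vertices, represented by listing
  -- the smaller endpoint first.  The proof fields are irrelevant, so edges with
  -- the same endpoints are equal.
  record Edge : Set where
    constructor mkEdge
    field
      end₁ end₂ : Vertex
      .ordered  : end₁ < end₂
      .adjacent : Adj end₁ end₂

  open Edge public

  Joins : Edge → Vertex → Vertex → Set
  Joins e u v = (end₁ e ≡ u × end₂ e ≡ v) ⊎ (end₁ e ≡ v × end₂ e ≡ u)

  FormPath : Edge → Edge → Edge → Set
  FormPath e₁ e₂ e₃ = ∃[ a ] ∃[ b ] ∃[ c ] ∃[ d ]
    Unique (a ∷ b ∷ c ∷ d ∷ []) × Joins e₁ a b × Joins e₂ b c × Joins e₃ c d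

  FormTriangle : Edge → Edge → Edge → Set
  FormTriangle e₁ e₂ e₃ = ∃[ a ] ∃[ b ] ∃[ c ]
    Unique (a ∷ b ∷ c ∷ []) × Joins e₁ a b × Joins e₂ b c × Joins e₃ c a

  Consecutive : Edge → Edge → Edge → Set
  Consecutive e₁ e₂ e₃ = FormPath e₁ e₂ e₃ ⊎ FormTriangle e₁ e₂ e₃

open Graph public using (maxDegree)

Subcubic : Graph → Set
Subcubic G = maxDegree G ≤ 3

Bipartite : Graph → Set
Bipartite G = ∃ λ (side : Vertex → Bool) → ∀ {u v} → Adj u v → side u ≢ side v
  where open Graph G

module _ (G : Graph) where
  open Graph G

  IsInjectiveColoring : ∀ {k} → (Edge → Fin k) → Set
  IsInjectiveColoring c = ∀ e₁ e₂ e₃ → Consecutive e₁ e₂ e₃ → c e₁ ≢ c e₃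

  InjectivelyColorable : ℕ → Set
  InjectivelyColorable k = ∃ λ (c : Edge → Fin k) → IsInjectiveColoring c

IsMinimum : (ℕ → Set) → ℕ → Set
IsMinimum P k = P k × (∀ {j} → P j → k ≤ j)

minimum : {P : ℕ → Set} → U.Decidable P → ∃ P → ∃ (IsMinimum P)
minimum {P} P? (k , pk) = <-rec (λ i → P i → ∃ (IsMinimum P)) step k pk
  where
  step : ∀ i → (∀ {j} → j ℕ.< i → P j → ∃ (IsMinimum P)) → P i → ∃ (IsMinimum P)
  step i rec pi with ℕ.anyUpTo? P? i
  ... | yes (_ , j<i , pj) = rec j<i pj
  ... | no  none           = i , pi , λ {j} pj → ℕ.≮⇒≥ (λ j<i → none (j , j<i , pj))

-- To take the minimum constructively, colorability with k colors is decided by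
-- searching the finitely many colorings, and coloring all edges differently
-- shows that some k works.

module _ (G : Graph) where
  open Graph G

  private
    edgesBetween : Vertex × Vertex → List Edge
    edgesBetween (u , v) with u <? v | Adj? u v
    ... | yes u<v | yes uv = [ mkEdge u v u<v uv ]
    ... | _       | _      = []

    ∈-edgesBetween : ∀ e → e ∈ edgesBetween (end₁ e , end₂ e)
    ∈-edgesBetween (mkEdge u v u<v uv) with u <? v | Adj? u v
    ... | yes _   | yes _  = here refl
    ... | no  u≮v | _      = contradiction-irr u<v u≮v
    ... | yes _   | no ¬uv = contradiction-irr uv ¬uv

  edges : List Edge
  edges = concatMap edgesBetween (cartesianProduct (allFin order) (allFin order))

  ∈-edges : ∀ e → e ∈ edges
  ∈-edges e = ∈-concatMap⁺ edgesBetween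
    (lose (∈-cartesianProduct⁺ (∈-allFin (end₁ e)) (∈-allFin (end₂ e))) (∈-edgesBetween e))

  edgeIndex : Edge → Fin (length edges)
  edgeIndex e = Any.index (∈-edges e)

  lookup-edgeIndex : ∀ e → lookup edges (edgeIndex e) ≡ e
  lookup-edgeIndex e = sym (lookup-index (∈-edges e))

  private
    joins? : ∀ e u v → Dec (Joins e u v)
    joins? e u v = ((end₁ e ≟ u) ×-dec (end₂ e ≟ v)) ⊎-dec ((end₁ e ≟ v) ×-dec (end₂ e ≟ u))

    unique? : (vs : List Vertex) → Dec (Unique vs)
    unique? = DecUnique.unique? _≟_

    consecutive? : ∀ e₁ e₂ e₃ → Dec (Consecutive e₁ e₂ e₃)
    consecutive? e₁ e₂ e₃ =
      (any? λ a → any? λ b → any? λ c → any? λ d →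
        unique? (a ∷ b ∷ c ∷ d ∷ []) ×-dec joins? e₁ a b ×-dec joins? e₂ b c ×-dec joins? e₃ c d)
      ⊎-dec
      (any? λ a → any? λ b → any? λ c →
        unique? (a ∷ b ∷ c ∷ []) ×-dec joins? e₁ a b ×-dec joins? e₂ b c ×-dec joins? e₃ c a)

    all-edges? : {P : Edge → Set} → U.Decidable P → Dec (∀ e → P e)
    all-edges? P? = map′ (λ ps e → All.lookup ps (∈-edges e)) (λ f → All.tabulate (λ {e} _ → f e)) (all? P? edges)

  isInjectiveColoring? : ∀ {k} (c : Edge → Fin k) → Dec (IsInjectiveColoring G c)
  isInjectiveColoring? c = all-edges? λ e₁ → all-edges? λ e₂ → all-edges? λ e₃ →
    consecutive? e₁ e₂ e₃ →-dec ¬? (c e₁ ≟ c e₃)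

  private
    isInjectiveColoring-resp : ∀ {k} {c c′ : Edge → Fin k} → (∀ e → c e ≡ c′ e) →
                               IsInjectiveColoring G c → IsInjectiveColoring G c′
    isInjectiveColoring-resp eq inj e₁ e₂ e₃ con c′e₁≡c′e₃ =
      inj e₁ e₂ e₃ con (trans (eq e₁) (trans c′e₁≡c′e₃ (sym (eq e₃))))

  injectivelyColorable? : U.Decidable (InjectivelyColorable G)
  injectivelyColorable? k = map′ (λ (i , inj) → decode i , inj) encode (any? (isInjectiveColoring? ∘ decode))
    where
    decode : Fin (k ℕ.^ length edges) → Edge → Fin k
    decode i = finToFun i ∘ edgeIndex

    encode : InjectivelyColorable G k → ∃ (IsInjectiveColoring G ∘ decode)
    encode (c , inj) = funToFin (c ∘ lookup edges) , isInjectiveColoring-resp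
      (λ e → sym (trans (finToFun-funToFin (c ∘ lookup edges) (edgeIndex e)) (cong c (lookup-edgeIndex e)))) inj

  private
    joins-unique : ∀ e {u v w x} → Joins e u v → Joins e w x → u ≡ w ⊎ u ≡ x
    joins-unique _ (inj₁ (refl , _)) (inj₁ (refl , _)) = inj₁ refl
    joins-unique _ (inj₁ (refl , _)) (inj₂ (refl , _)) = inj₂ refl
    joins-unique _ (inj₂ (_ , refl)) (inj₁ (_ , refl)) = inj₂ refl
    joins-unique _ (inj₂ (_ , refl)) (inj₂ (_ , refl)) = inj₁ refl

    joins-sym : ∀ e {u v} → Joins e u v → Joins e v u
    joins-sym _ (inj₁ p) = inj₂ p
    joins-sym _ (inj₂ p) = inj₁ p

    consecutive⇒≢ : ∀ e₁ e₂ e₃ → Consecutive e₁ e₂ e₃ → e₁ ≢ e₃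
    consecutive⇒≢ e₁ e₂ _ (inj₁ (a , b , c , d , (_ ∷ a≢c ∷ a≢d ∷ []) ∷ _ , j₁ , _ , j₃)) refl with joins-unique e₁ j₁ j₃
    ... | inj₁ a≡c = a≢c a≡c
    ... | inj₂ a≡d = a≢d a≡d
    consecutive⇒≢ e₁ e₂ _ (inj₂ (a , b , c , (a≢b ∷ _) ∷ (b≢c ∷ []) ∷ _ , j₁ , _ , j₃)) refl with joins-unique e₁ (joins-sym e₁ j₁) j₃
    ... | inj₁ b≡c = b≢c b≡c
    ... | inj₂ b≡a = a≢b (sym b≡a)

  edgeIndex-isInjectiveColoring : IsInjectiveColoring G edgeIndex
  edgeIndex-isInjectiveColoring e₁ e₂ e₃ con eq = consecutive⇒≢ e₁ e₂ e₃ con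
    (trans (sym (lookup-edgeIndex e₁)) (trans (cong (lookup edges) eq) (lookup-edgeIndex e₃)))

  private
    minimumColors : ∃ (IsMinimum (InjectivelyColorable G))
    minimumColors = minimum injectivelyColorable? (length edges , edgeIndex , edgeIndex-isInjectiveColoring)

  χ′inj : ℕ
  χ′inj = proj₁ minimumColors

  χ′inj-isMinimum : IsMinimum (InjectivelyColorable G) χ′inj
  χ′inj-isMinimum = proj₂ minimumColors

{-# OPTIONS --safe #-}

-- Call two vertices linked if they have a common neighbour; a vertex is linked
-- to at most 6 others.  Colour the vertices with 6 colours so that linked
-- vertices differ, leaving as few vertices uncoloured ("holes") as possible.
-- Then the vertices linked to a hole carry each colour exactly once, and a hole
-- can be moved to any linked vertex by passing that vertex's colour back.  If
-- two holes were joined by a chain of links, moving one towards the other would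
-- make a colour available; so no two holes are connected by links.
--
-- Giving each edge the colour of its endpoint on one fixed side of the
-- bipartition is an injective edge-colouring away from the holes, which exist
-- exactly when some component of the linked vertices is a K₇, by Brooks'
-- theorem.  That theorem is not needed: a hole r is repaired by choosing a
-- neighbour b of r, with further neighbours x and y, and giving the edges at b
-- the colour of x and all other edges at r, x and y the colour of y.  Moving
-- the hole to x and y shows that neither colour occurs at the vertices linked
-- to r, x or y through a vertex other than b.
module Submission where

open import Data.Bool.Base using (Bool; true; false)
open import Data.Empty using (⊥-elim)
open import Data.Fin.Base using (Fin; zero)
open import Data.Fin.Properties using (_≟_; any?; injective⇒≤)
open import Data.List.Base using (List; []; _∷_; length; map; filter; concatMap; allFin; head; lookup)
open import Data.List.Membership.Propositional using (_∈_; _∉_; lose)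
open import Data.List.Membership.Propositional.Properties
  using (∈-allFin; ∈-filter⁺; ∈-filter⁻; ∈-map⁺; ∈-concatMap⁺)
open import Data.List.Properties using (filter-notAll; length-++; length-map)
open import Data.List.Extrema.Nat using (xs≤max)
open import Data.List.Relation.Unary.All as All using (_∷_)
open import Data.List.Relation.Unary.AllPairs using (_∷_)
open import Data.List.Relation.Unary.Any as Any using (Any; here; there)
open import Data.List.Relation.Unary.Any.Properties using (lookup-index)
open import Data.List.Relation.Unary.Unique.Propositional using (Unique)
open import Data.List.Relation.Unary.Unique.Propositional.Properties using (allFin⁺; filter⁺)
import Data.List.Membership.DecPropositional as DecMembership
open import Data.Maybe.Base using (just)
open import Data.Maybe.Properties using (just-injective) renaming (≡-dec to Maybe-≡-dec)
open import Data.Nat.Base using (_≤_; _<_; _*_; s≤s; s≤s⁻¹)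
open import Data.Nat.Induction using (<-rec)
open import Data.Nat.Properties
  using (≤-refl; ≤-reflexive; ≤-trans; <-≤-trans; ≤-<-trans; <⇒≱; ≮⇒≥; _≤?_; _<?_;
         +-mono-≤; +-mono-<-≤; +-mono-≤-<; *-monoˡ-≤)
open import Data.Product.Base using (∃; ∃-syntax; ∃₂; _×_; _,_; proj₁; proj₂)
open import Data.Product.Properties using () renaming (≡-dec to ×-≡-dec)
open import Data.Sum.Base using (inj₁; inj₂)
open import Data.Vec.Functional using (Vector; updateAt)
open import Data.Vec.Functional.Properties using (updateAt-updates; updateAt-minimal)
open import Function.Base using (const; _∘_)
open import Relation.Binary.Construct.Closure.ReflexiveTransitive using (Star; ε; _◅_)
open import Relation.Binary.Definitions using (DecidableEquality)
open import Relation.Binary.PropositionalEquality using (_≡_; _≢_; refl; sym; trans; cong; subst; ≢-sym)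
open import Relation.Nullary.Decidable using (Dec; yes; no; _×-dec_; ¬?; decidable-stable; recompute)
open import Relation.Nullary.Negation.Core using (¬_; contradiction)
open import Defs

-- Counting and pigeonhole for lists.

length-concatMap-≤ : ∀ {A B : Set} {k} (f : A → List B) xs →
                     (∀ {x} → x ∈ xs → length (f x) ≤ k) → length (concatMap f xs) ≤ length xs * k
length-concatMap-≤ f []       bound = ≤-refl
length-concatMap-≤ f (x ∷ xs) bound = ≤-trans (≤-reflexive (length-++ (f x)))
  (+-mono-≤ (bound (here refl)) (length-concatMap-≤ f xs (bound ∘ there)))

length-concatMap-< : ∀ {A B : Set} {k} (f : A → List B) xs → (∀ {x} → x ∈ xs → length (f x) ≤ k) →
                     Any (λ x → length (f x) < k) xs → length (concatMap f xs) < length xs * k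
length-concatMap-< f (x ∷ xs) bound (here short)  = ≤-<-trans (≤-reflexive (length-++ (f x)))
  (+-mono-<-≤ short (length-concatMap-≤ f xs (bound ∘ there)))
length-concatMap-< f (x ∷ xs) bound (there short) = ≤-<-trans (≤-reflexive (length-++ (f x)))
  (+-mono-≤-< (bound (here refl)) (length-concatMap-< f xs (bound ∘ there) short))

two-distinct : ∀ {A : Set} {xs : List A} → Unique xs → 2 ≤ length xs → ∃₂ λ x y → x ∈ xs × y ∈ xs × x ≢ y
two-distinct {xs = _ ∷ []}    _                 (s≤s ())
two-distinct {xs = x ∷ y ∷ _} ((x≢y ∷ _) ∷ _) _ = x , y , here refl , there (here refl) , x≢y

∈⇒head : ∀ {A : Set} {x : A} {xs} → x ∈ xs → ∃[ y ] head xs ≡ just y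
∈⇒head {xs = y ∷ _} _ = y , refl

head⇒∈ : ∀ {A : Set} {x : A} {xs} → head xs ≡ just x → x ∈ xs
head⇒∈ {xs = _ ∷ _} refl = here refl

missing-element : ∀ {n} (xs : List (Fin n)) → length xs < n → ∃[ i ] i ∉ xs
missing-element {n} xs short with any? (λ i → ¬? (i ∈? xs))
  where open DecMembership (_≟_ {n}) using (_∈?_)
... | yes found = found
... | no  none  = contradiction (injective⇒≤ index-injective) (<⇒≱ short)
  where
  open DecMembership (_≟_ {n}) using (_∈?_)

  everywhere : ∀ i → i ∈ xs
  everywhere i = decidable-stable (i ∈? xs) (λ i∉xs → none (i , i∉xs))

  index-injective : ∀ {i j} → Any.index (everywhere i) ≡ Any.index (everywhere j) → i ≡ j
  index-injective {i} {j} eq = trans (lookup-index (everywhere i))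
    (trans (cong (lookup xs) eq) (sym (lookup-index (everywhere j))))

-- Walks of length two in a subcubic graph.

module _ (G : Graph) (subcubic : Subcubic G) where
  open Graph G
  open DecMembership (_≟_ {order}) using (_∈?_)

  neighbours : Vertex → List Vertex
  neighbours v = filter (Adj? v) (allFin order)

  ∈-neighbours⁺ : ∀ {u v} → Adj u v → v ∈ neighbours u
  ∈-neighbours⁺ {u} {v} uv = ∈-filter⁺ (Adj? u) (∈-allFin v) uv

  ∈-neighbours⁻ : ∀ {u v} → v ∈ neighbours u → Adj u v
  ∈-neighbours⁻ {u} v∈ = proj₂ (∈-filter⁻ (Adj? u) {xs = allFin order} v∈)

  degree≤3 : ∀ v → length (neighbours v) ≤ 3
  degree≤3 v = ≤-trans (All.lookup (xs≤max 0 (map degree (allFin order))) (∈-map⁺ degree (∈-allFin v))) subcubic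

  siblings : Vertex → Vertex → List Vertex
  siblings v b = filter (λ u → ¬? (u ≟ v)) (neighbours b)

  length-siblings : ∀ {v b} → Adj v b → length (siblings v b) ≤ 2
  length-siblings {v} {b} vb = s≤s⁻¹ (<-≤-trans
    (filter-notAll (λ u → ¬? (u ≟ v)) (neighbours b) (lose (∈-neighbours⁺ (symmetric vb)) (λ v≢v → v≢v refl)))
    (degree≤3 b))

  -- The middle vertex is recorded, so a vertex reached through two middles is listed twice. Such
  -- repetitions are what `walks-rainbow` excludes around a hole.
  walks : Vertex → List (Vertex × Vertex)
  walks v = concatMap (λ b → map (b ,_) (siblings v b)) (neighbours v)

  ∈-walks : ∀ {v b u} → Adj v b → Adj u b → u ≢ v → (b , u) ∈ walks v
  ∈-walks {v} {b} {u} vb ub u≢v = ∈-concatMap⁺ (λ b → map (b ,_) (siblings v b))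
    (lose (∈-neighbours⁺ vb)
      (∈-map⁺ (b ,_) (∈-filter⁺ (λ u → ¬? (u ≟ v)) (∈-neighbours⁺ (symmetric ub)) u≢v)))

  length-walks-bound : ∀ {v b} → b ∈ neighbours v → length (map (b ,_) (siblings v b)) ≤ 2
  length-walks-bound {v} {b} b∈ =
    ≤-trans (≤-reflexive (length-map (b ,_) (siblings v b))) (length-siblings (∈-neighbours⁻ b∈))

  length-walks : ∀ v → length (walks v) ≤ 6
  length-walks v = ≤-trans (length-concatMap-≤ _ (neighbours v) length-walks-bound) (*-monoˡ-≤ 2 (degree≤3 v))

  few-walks : ∀ {v b} → Adj v b → length (siblings v b) < 2 → length (walks v) < 6
  few-walks {v} {b} vb short = <-≤-trans
    (length-concatMap-< _ (neighbours v) length-walks-bound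
      (lose (∈-neighbours⁺ vb) (≤-<-trans (≤-reflexive (length-map (b ,_) (siblings v b))) short)))
    (*-monoˡ-≤ 2 (degree≤3 v))

  _≟ʷ_ : DecidableEquality (Vertex × Vertex)
  _≟ʷ_ = ×-≡-dec _≟_ _≟_

  -- Reflexive at every vertex that is not isolated.
  Linked : Vertex → Vertex → Set
  Linked u v = ∃[ b ] Adj u b × Adj v b

  -- The values of color at holes are irrelevant.
  record PartialColoring : Set where
    field
      holes  : List Vertex
      color  : Vector (Fin 6) order
      proper : ∀ {u v} → Linked u v → u ≢ v → u ∉ holes → v ∉ holes → color u ≢ color v

  open PartialColoring

  Minimal : PartialColoring → Set
  Minimal s = ∀ t → length (holes s) ≤ length (holes t)

  -- Filling and moving holes.

  module _ (s : PartialColoring) where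

    remove : Vertex → List Vertex
    remove r = filter (λ v → ¬? (v ≟ r)) (holes s)

    remove-shorter : ∀ {r} → r ∈ holes s → length (remove r) < length (holes s)
    remove-shorter r∈ = filter-notAll _ (holes s) (lose r∈ (λ r≢r → r≢r refl))

    ∉-remove : ∀ {r v} → v ≢ r → v ∉ remove r → v ∉ holes s
    ∉-remove v≢r v∉ v∈ = v∉ (∈-filter⁺ _ v∈ v≢r)

    -- Serves both to fill the hole `r`, with `hs` equal to `remove r`, and to move it to `z`, with
    -- `hs` equal to `z ∷ remove r`.
    recolor : ∀ r i hs → (∀ {v} → v ≢ r → v ∉ hs → v ∉ holes s) →
              (∀ {v} → Linked r v → v ≢ r → v ∉ hs → color s v ≢ i) → PartialColoring
    recolor r i hs shrink available = record
      { holes = hs ; color = updateAt (color s) r (const i) ; proper = proper′ }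
      where
      proper′ : ∀ {u v} → Linked u v → u ≢ v → u ∉ hs → v ∉ hs →
                updateAt (color s) r (const i) u ≢ updateAt (color s) r (const i) v
      proper′ {u} {v} uv@(b , ub , vb) u≢v u∉ v∉ eq with u ≟ r | v ≟ r
      ... | yes refl | yes refl = u≢v refl
      ... | yes refl | no v≢r   = available uv v≢r v∉
        (trans (sym (updateAt-minimal v r (color s) v≢r)) (trans (sym eq) (updateAt-updates r (color s))))
      ... | no u≢r   | yes refl = available (b , vb , ub) u≢r u∉
        (trans (sym (updateAt-minimal u r (color s) u≢r)) (trans eq (updateAt-updates r (color s))))
      ... | no u≢r   | no v≢r   = proper s uv u≢v (shrink u≢r u∉) (shrink v≢r v∉)
        (trans (sym (updateAt-minimal u r (color s) u≢r)) (trans eq (updateAt-minimal v r (color s) v≢r)))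

    module _ (minimal : Minimal s) where

      -- A colour missing from `vs` could be given to `r`, leaving fewer holes.
      hole-not-coverable : ∀ {r} → r ∈ holes s → (vs : List Vertex) → length vs < 6 →
        ¬ (∀ {v} → Linked r v → v ≢ r → v ∉ holes s → ∃[ u ] u ∈ vs × color s u ≡ color s v)
      hole-not-coverable {r} r∈ vs short cover
        with i , i∉ ← missing-element (map (color s) vs) (≤-<-trans (≤-reflexive (length-map (color s) vs)) short)
        = <⇒≱ (remove-shorter r∈) (minimal (recolor r i (remove r) ∉-remove available))
        where
        available : ∀ {v} → Linked r v → v ≢ r → v ∉ remove r → color s v ≢ i
        available rv v≢r v∉ refl with u , u∈ , eq ← cover rv v≢r (∉-remove v≢r v∉)
          = i∉ (subst (_∈ map (color s) vs) eq (∈-map⁺ (color s) u∈))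

      -- Without this walk at most five remain, too few to block all six colours at `r`. Assuming
      -- `u ∉ holes s` lets an uncoloured `u` count as redundant.
      walk-essential : ∀ {r b u} → r ∈ holes s → Adj r b → Adj u b → u ≢ r →
        ¬ (u ∉ holes s → ∃[ w ] w ∈ walks r × w ≢ (b , u) × color s (proj₂ w) ≡ color s u)
      walk-essential {r} {b} {u} r∈ rb ub u≢r redundant =
        hole-not-coverable r∈ (map proj₂ others)
          (≤-<-trans (≤-reflexive (length-map proj₂ others)) (<-≤-trans fewer (length-walks r))) cover
        where
        others : List (Vertex × Vertex)
        others = filter (λ w → ¬? (w ≟ʷ (b , u))) (walks r)

        fewer : length others < length (walks r)
        fewer = filter-notAll _ (walks r) (lose (∈-walks rb ub u≢r) (λ w≢w → w≢w refl))

        cover : ∀ {v} → Linked r v → v ≢ r → v ∉ holes s → ∃[ x ] x ∈ map proj₂ others × color s x ≡ color s v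
        cover {v} (c , rc , vc) v≢r v∉ with (c , v) ≟ʷ (b , u)
        ... | no  w≢   = v , ∈-map⁺ proj₂ (∈-filter⁺ _ (∈-walks rc vc v≢r) w≢) , refl
        ... | yes refl with w , w∈ , w≢ , eq ← redundant v∉ = proj₂ w , ∈-map⁺ proj₂ (∈-filter⁺ _ w∈ w≢) , eq

      linked-to-hole : ∀ {r u} → r ∈ holes s → Linked r u → u ≢ r → u ∉ holes s
      linked-to-hole r∈ (b , rb , ub) u≢r u∈ = walk-essential r∈ rb ub u≢r (contradiction u∈)

      -- A second walk ending in the same colour would make the first redundant. For `u` equal to
      -- `v` this says that the middle vertex is unique.
      walks-rainbow : ∀ {r b c u v} → r ∈ holes s → Adj r b → Adj u b → u ≢ r → Adj r c → Adj v c → v ≢ r →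
                      color s v ≡ color s u → (c , v) ≡ (b , u)
      walks-rainbow {r} {b} {c} {u} {v} r∈ rb ub u≢r rc vc v≢r eq = decidable-stable ((c , v) ≟ʷ (b , u))
        (λ w≢ → walk-essential r∈ rb ub u≢r (λ _ → (c , v) , ∈-walks rc vc v≢r , w≢ , eq))

      two-siblings : ∀ {r b} → r ∈ holes s → Adj r b →
                     ∃₂ λ x y → Adj x b × Adj y b × x ≢ r × y ≢ r × x ≢ y
      two-siblings {r} {b} r∈ rb with length (siblings r b) <? 2
      ... | yes short = ⊥-elim (hole-not-coverable r∈ (map proj₂ (walks r))
                          (≤-<-trans (≤-reflexive (length-map proj₂ (walks r))) (few-walks rb short)) cover)
        where
        cover : ∀ {v} → Linked r v → v ≢ r → v ∉ holes s → ∃[ x ] x ∈ map proj₂ (walks r) × color s x ≡ color s v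
        cover {v} (c , rc , vc) v≢r _ = v , ∈-map⁺ proj₂ (∈-walks rc vc v≢r) , refl
      ... | no long
        with x , y , x∈ , y∈ , x≢y ← two-distinct (filter⁺ (λ u → ¬? (u ≟ r)) (filter⁺ (Adj? b) (allFin⁺ order))) (≮⇒≥ long)
        with x∈′ , x≢r ← ∈-filter⁻ (λ u → ¬? (u ≟ r)) {xs = neighbours b} x∈
        with y∈′ , y≢r ← ∈-filter⁻ (λ u → ¬? (u ≟ r)) {xs = neighbours b} y∈
        = x , y , symmetric (∈-neighbours⁻ x∈′) , symmetric (∈-neighbours⁻ y∈′) , x≢r , y≢r , x≢y

      -- Among the vertices linked to `r`, only `z` has its colour; once `z` is a hole, that colour
      -- is free for `r`.
      slide : ∀ {r z} → r ∈ holes s → Linked r z → z ≢ r → PartialColoring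
      slide {r} {z} r∈ (b , rb , zb) z≢r =
        recolor r (color s z) (z ∷ remove r) (λ v≢r v∉ → ∉-remove v≢r (v∉ ∘ there)) available
        where
        available : ∀ {v} → Linked r v → v ≢ r → v ∉ z ∷ remove r → color s v ≢ color s z
        available (c , rc , vc) v≢r v∉ eq =
          v∉ (here (cong proj₂ (walks-rainbow r∈ rb zb z≢r rc vc v≢r eq)))

      slide-minimal : ∀ {r z} (r∈ : r ∈ holes s) (rz : Linked r z) (z≢r : z ≢ r) → Minimal (slide r∈ rz z≢r)
      -- The strict inequality in `remove-shorter` pays for the added hole `z`.
      slide-minimal r∈ rz z≢r t = ≤-trans (remove-shorter r∈) (minimal t)

      hole-at : ∀ {r z} → r ∈ holes s → Linked r z →
                ∃[ t ] Minimal t × z ∈ holes t × (∀ {v} → v ≢ r → color t v ≡ color s v)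
      hole-at {r} {z} r∈ rz with z ≟ r
      ... | yes refl = s , minimal , r∈ , λ _ → refl
      ... | no  z≢r  = slide r∈ rz z≢r , slide-minimal r∈ rz z≢r , here refl , updateAt-minimal _ r (color s)

  -- Induction on the chain. Moving the hole from `q` to its successor `z` keeps `r` a hole, so the
  -- shorter chain gives `z ≡ r`. Then `q` and `z` are linked holes of `s`, contradicting
  -- minimality.
  connected-holes : ∀ s → Minimal s → ∀ {q r} → q ∈ holes s → r ∈ holes s → Star Linked q r → q ≡ r
  connected-holes s minimal q∈ r∈ ε = refl
  connected-holes s minimal {q} {r} q∈ r∈ (_◅_ {j = z} qz rest) with q ≟ r | z ≟ q
  ... | yes q≡r | _        = q≡r
  ... | no _    | yes refl = connected-holes s minimal q∈ r∈ rest
  ... | no q≢r  | no z≢q   = contradiction (subst (_∈ holes s) (sym z≡r) r∈) (linked-to-hole s minimal q∈ qz z≢q)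
    where
    z≡r : z ≡ r
    z≡r = connected-holes (slide s minimal q∈ qz z≢q) (slide-minimal s minimal q∈ qz z≢q)
      (here refl) (there (∈-filter⁺ _ r∈ (≢-sym q≢r))) rest

  -- Repairing the holes.

  module _ (s : PartialColoring) (minimal : Minimal s) where

    -- `inner` is meant for the edges at `b`, `outer` for the other edges at neighbours of `b`. The
    -- vertices `w` in `avoided` are those whose own colour could clash with these.
    record Palette (b : Vertex) : Set where
      field
        inner outer : Fin 6
        inner≢outer : inner ≢ outer
        avoided     : ∀ {z w c} → Adj z b → Adj z c → Adj w c → ¬ Adj w b →
                      color s w ≢ inner × color s w ≢ outer

    -- If `u` is `z`, then `w` is linked to `u` and both are coloured: a hole at `w` would be
    -- connected to `r`, hence equal to it. Otherwise move the hole to `z`, around which `u` and `w`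
    -- would repeat a colour.
    fresh : ∀ {r b u z c w} → r ∈ holes s → Adj r b → Adj u b → u ≢ r →
            Adj z b → Adj z c → Adj w c → ¬ Adj w b → color s w ≢ color s u
    fresh {r} {b} {u} {z} {c} {w} r∈ rb ub u≢r zb zc wc ¬wb eq with u ≟ z
    ... | yes refl = proper s (c , wc , zc) w≢z w∉ (linked-to-hole s minimal r∈ (b , rb , ub) u≢r) eq
      where
      w≢z : w ≢ z
      w≢z refl = ¬wb ub
      w∉ : w ∉ holes s
      w∉ w∈ = ¬wb (subst (λ v → Adj v b)
        (connected-holes s minimal r∈ w∈ ((b , rb , zb) ◅ (c , zc , wc) ◅ ε)) rb)
    ... | no u≢z
      with t , t-minimal , z∈ , same ← hole-at s minimal r∈ (b , rb , zb)
      with walks-rainbow t t-minimal z∈ zb ub u≢z zc wc (λ { refl → ¬wb zb })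
             (trans (same (λ { refl → ¬wb rb })) (trans eq (sym (same u≢r))))
    ... | refl = ¬wb ub

    palette : ∀ {r b} → r ∈ holes s → Adj r b → Palette b
    palette {r} {b} r∈ rb with x , y , xb , yb , x≢r , y≢r , x≢y ← two-siblings s minimal r∈ rb = record
      { inner       = color s x
      ; outer       = color s y
      ; inner≢outer = proper s (b , xb , yb) x≢y (linked-to-hole s minimal r∈ (b , rb , xb) x≢r)
                                                 (linked-to-hole s minimal r∈ (b , rb , yb) y≢r)
      ; avoided     = λ zb zc wc ¬wb → fresh r∈ rb xb x≢r zb zc wc ¬wb , fresh r∈ rb yb y≢r zb zc wc ¬wb
      }

    -- b is the neighbour chosen to repair some hole.
    Centre : Vertex → Set
    Centre b = ∃[ r ] r ∈ holes s × head (neighbours r) ≡ just b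

    centre? : ∀ b → Dec (Centre b)
    centre? b = any? λ r → (r ∈? holes s) ×-dec Maybe-≡-dec _≟_ (head (neighbours r)) (just b)

    Bordering : Vertex → Set
    Bordering a = ∃[ b ] Adj a b × Centre b

    bordering? : ∀ a → Dec (Bordering a)
    bordering? a = any? λ b → Adj? a b ×-dec centre? b

    -- Ensures that the `plain` shade of an edge never reads the colour of a hole.
    hole-bordering : ∀ {a b} → Adj a b → a ∈ holes s → Bordering a
    hole-bordering {a} ab a∈ with c , eq ← ∈⇒head (∈-neighbours⁺ ab) = c , ∈-neighbours⁻ (head⇒∈ eq) , a , a∈ , eq

    -- The holes behind `b` and `d` are joined by links, so they coincide, and a hole chooses only
    -- one neighbour.
    connected-centres : ∀ {b c d y z} → Centre b → Centre d → Adj y b → Adj y c → Adj z c → Adj z d → b ≡ d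
    connected-centres {b} {c} {d} (q , q∈ , qb) (r , r∈ , rd) yb yc zc zd
      with refl ← connected-holes s minimal q∈ r∈
                    ((b , ∈-neighbours⁻ (head⇒∈ qb) , yb) ◅ (c , yc , zc) ◅ (d , zd , ∈-neighbours⁻ (head⇒∈ rd)) ◅ ε)
      = just-injective (trans (sym qb) rd)

    -- With the hole moved to `y`, walks to `z` through both `b` and `c` would repeat the colour of
    -- `z`.
    linear : ∀ {b c y z} → Centre b → Adj y b → Adj z b → y ≢ z → Adj y c → Adj z c → c ≡ b
    linear {b} (r , r∈ , rb) yb zb y≢z yc zc
      with t , t-minimal , y∈ , _ ← hole-at s minimal r∈ (b , ∈-neighbours⁻ (head⇒∈ rb) , yb)
      = cong proj₁ (walks-rainbow t t-minimal y∈ yb zb (≢-sym y≢z) yc zc (≢-sym y≢z) refl)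

    centre-palette : ∀ {b} → Centre b → Palette b
    centre-palette (r , r∈ , rb) = palette r∈ (∈-neighbours⁻ (head⇒∈ rb))

    -- Taking the evidence from `centre?` makes the colours depend on `b` alone. The value `zero` is
    -- arbitrary, as `Shade` consults only centres.
    inner outer : Vertex → Fin 6
    inner b with centre? b
    ... | yes centre = Palette.inner (centre-palette centre)
    ... | no  _      = zero
    outer b with centre? b
    ... | yes centre = Palette.outer (centre-palette centre)
    ... | no  _      = zero

    inner≢outer : ∀ {b} → Centre b → inner b ≢ outer b
    inner≢outer {b} centre with centre? b
    ... | yes p = Palette.inner≢outer (centre-palette p)
    ... | no ¬p = contradiction centre ¬p

    inner-avoided : ∀ {b z w c} → Centre b → Adj z b → Adj z c → Adj w c → ¬ Adj w b → color s w ≢ inner b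
    inner-avoided {b} centre zb zc wc ¬wb with centre? b
    ... | yes p = proj₁ (Palette.avoided (centre-palette p) zb zc wc ¬wb)
    ... | no ¬p = contradiction centre ¬p

    outer-avoided : ∀ {b z w c} → Centre b → Adj z b → Adj z c → Adj w c → ¬ Adj w b → color s w ≢ outer b
    outer-avoided {b} centre zb zc wc ¬wb with centre? b
    ... | yes p = proj₂ (Palette.avoided (centre-palette p) zb zc wc ¬wb)
    ... | no ¬p = contradiction centre ¬p

    -- The edge from `a` to `b`, with `a` on the side that supplies the vertex colours. As a
    -- relation it lets proofs split on the rule applied.
    data Shade (a b : Vertex) : Fin 6 → Set where
      central : Centre b → Shade a b (inner b)
      border  : ∀ {c} → ¬ Centre b → Adj a c → Centre c → Shade a b (outer c)
      plain   : ¬ Centre b → ¬ Bordering a → Shade a b (color s a)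

    shade : ∀ a b → ∃ (Shade a b)
    shade a b with centre? b | bordering? a
    ... | yes cb | _                = _ , central cb
    ... | no ¬cb | yes (c , ac , cc) = _ , border ¬cb ac cc
    ... | no ¬cb | no ¬ba            = _ , plain ¬cb ¬ba

    shades-differ : ∀ {a b c d i j} → Adj a b → Adj c b → Adj c d → a ≢ c → b ≢ d →
                    Shade a b i → Shade c d j → i ≢ j
    shades-differ ab cb cd a≢c b≢d (central pb) (central pd) eq =
      b≢d (connected-centres pb pd cb cb cb cd)
    shades-differ ab cb cd a≢c b≢d (central pb) (border ¬pd ce pe) eq
      with refl ← connected-centres pb pe cb cb cb ce = inner≢outer pb eq
    shades-differ ab cb cd a≢c b≢d (central pb) (plain ¬pd ¬border) eq = ¬border (_ , cb , pb)
    shades-differ ab cb cd a≢c b≢d (border ¬pb ae pe) (central pd) eq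
      with refl ← connected-centres pe pd ae ab cb cd = inner≢outer pe (sym eq)
    -- Both edges border the same centre; `a` and `c` share it and `b`, so `b` would be that centre.
    shades-differ ab cb cd a≢c b≢d (border ¬pb ae pe) (border ¬pd cf pf) eq
      with refl ← connected-centres pe pf ae ab cb cf
      with refl ← linear pe ae cf a≢c ab cb = ¬pb pe
    shades-differ ab cb cd a≢c b≢d (border ¬pb ae pe) (plain ¬pd ¬border) eq =
      outer-avoided pe ae ab cb (λ ce → ¬border (_ , ce , pe)) (sym eq)
    shades-differ ab cb cd a≢c b≢d (plain ¬pb ¬border) (central pd) eq =
      inner-avoided pd cd cb ab (λ ad → ¬border (_ , ad , pd)) eq
    shades-differ ab cb cd a≢c b≢d (plain ¬pb ¬border) (border ¬pd cf pf) eq =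
      outer-avoided pf cf cb ab (λ af → ¬border (_ , af , pf)) eq
    shades-differ ab cb cd a≢c b≢d (plain ¬pb ¬border) (plain ¬pd ¬border′) eq =
      proper s (_ , ab , cb) a≢c (¬border ∘ hole-bordering ab) (¬border′ ∘ hole-bordering cb) eq

    tint : Vertex → Vertex → Fin 6
    tint a b = proj₁ (shade a b)

    tints-differ : ∀ {a b c d} → Adj a b → Adj c b → Adj c d → a ≢ c → b ≢ d → tint a b ≢ tint c d
    tints-differ {a} {b} {c} {d} ab cb cd a≢c b≢d = shades-differ ab cb cd a≢c b≢d (proj₂ (shade a b)) (proj₂ (shade c d))

    -- The edge colouring from the bipartition.

    module _ (side : Vertex → Bool) (bipartite : ∀ {u v} → Adj u v → side u ≢ side v) where

      orient : Bool → Vertex → Vertex → Fin 6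
      orient true  u v = tint u v
      orient false u v = tint v u

      edgeColor : Edge → Fin 6
      edgeColor e = orient (side (end₁ e)) (end₁ e) (end₂ e)

      joins⇒adjacent : ∀ e {u v} → Joins e u v → Adj u v
      joins⇒adjacent (mkEdge x y _ xy) (inj₁ (refl , refl)) = recompute (Adj? x y) xy
      joins⇒adjacent (mkEdge x y _ xy) (inj₂ (refl , refl)) = symmetric (recompute (Adj? x y) xy)

      orient-swap : ∀ {u v} → Adj u v → orient (side u) u v ≡ orient (side v) v u
      orient-swap {u} {v} uv with side u | side v | bipartite uv
      ... | true  | true  | u≢v = contradiction refl u≢v
      ... | true  | false | _   = refl
      ... | false | true  | _   = refl
      ... | false | false | u≢v = contradiction refl u≢v

      edgeColor-joins : ∀ e {u v} → Joins e u v → edgeColor e ≡ orient (side u) u v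
      edgeColor-joins e (inj₁ (refl , refl)) = refl
      edgeColor-joins e j@(inj₂ (refl , refl)) = sym (orient-swap (joins⇒adjacent e j))

      same-side : ∀ {u v w} → Adj u v → Adj v w → side u ≡ side w
      same-side {u} {v} {w} uv vw with side u | side v | side w | bipartite uv | bipartite vw
      ... | true  | true  | _     | u≢v | _   = contradiction refl u≢v
      ... | true  | false | true  | _   | _   = refl
      ... | true  | false | false | _   | v≢w = contradiction refl v≢w
      ... | false | true  | true  | _   | v≢w = contradiction refl v≢w
      ... | false | true  | false | _   | _   = refl
      ... | false | false | _     | u≢v | _   = contradiction refl u≢v

      orients-differ : ∀ {a b c d} k → Adj a b → Adj b c → Adj c d → a ≢ c → b ≢ d → orient k a b ≢ orient k c d
      orients-differ true  ab bc cd a≢c b≢d = tints-differ ab (symmetric bc) cd a≢c b≢d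
      -- Here `b` and `d` supply the colours, so the path is read from `d` to `a`.
      orients-differ false ab bc cd a≢c b≢d =
        ≢-sym (tints-differ (symmetric cd) bc (symmetric ab) (≢-sym b≢d) (≢-sym a≢c))

      edgeColor-injective : IsInjectiveColoring G edgeColor
      edgeColor-injective e₁ e₂ e₃ (inj₁ (a , b , c , d , (_ ∷ a≢c ∷ _) ∷ (_ ∷ b≢d ∷ _) ∷ _ , j₁ , j₂ , j₃)) eq =
        orients-differ (side a) ab bc cd a≢c b≢d
          (trans (sym (edgeColor-joins e₁ j₁)) (trans eq (trans (edgeColor-joins e₃ j₃)
            (cong (λ k → orient k c d) (sym (same-side ab bc))))))
        where
        ab = joins⇒adjacent e₁ j₁
        bc = joins⇒adjacent e₂ j₂
        cd = joins⇒adjacent e₃ j₃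
      edgeColor-injective e₁ e₂ e₃ (inj₂ (a , b , c , _ , j₁ , j₂ , j₃)) _ =
        bipartite (joins⇒adjacent e₃ j₃) (sym (same-side (joins⇒adjacent e₁ j₁) (joins⇒adjacent e₂ j₂)))

  -- Strong induction on the number of holes, starting from all vertices uncoloured. The double
  -- negation avoids deciding whether fewer holes are possible; it is harmless because the final
  -- bound is decidable.
  ¬¬minimal : ¬ (∀ s → ¬ Minimal s)
  ¬¬minimal none = <-rec (λ n → ∀ s → length (holes s) ≢ n)
    (λ { _ rec s refl → none s (λ t → ≮⇒≥ (λ t<s → rec t<s t refl)) })
    (length (allFin order)) allHoles refl
    where
    allHoles : PartialColoring
    allHoles = record { holes = allFin order ; color = const zero ; proper = λ _ _ u∉ → contradiction (∈-allFin _) u∉ }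

theorem1p13 : (G : Graph) → Subcubic G → Bipartite G → χ′inj G ≤ 6
theorem1p13 G subcubic (side , bipartite) = decidable-stable (χ′inj G ≤? 6) λ χ≰6 →
  ¬¬minimal G subcubic λ s minimal → χ≰6 (proj₂ (χ′inj-isMinimum G)
    (edgeColor G subcubic s minimal side bipartite , edgeColor-injective G subcubic s minimal side bipartite))
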